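{- Let $G$ be a finite simple undirected graph with $n$ nodes, maximum degree $\Delta(G)$ and no isolated nodes, and let $\tau$ be the strict majority threshold assignment of $G$. Then $$\overleftrightarrow{MTT}(G,\tau)\ge\frac{2n}{\Delta(G)+1}.$$
   Context: For a graph $G=(V,E)$, $N(v)$ is the set of neighbors of $v$ and $d(v)=|N(v)|$. A threshold assignment is a function $\tau:V\to\mathbb{N}\cup\{0\}$ with $0\le\tau(v)\le d(v)$ for all $v$. The strict majority threshold assignment is $\tau(v)=\lceil (d(v)+1)/2\rceil$. A finite sequence $\mathcal{S}_0,\ldots,\mathcal{S}_k$ of subsets of $V$ (for some integer $k$) is a timed target set (TTS) of $(G,\tau)$ (in the non-progressive model) if there is a sequence $Q_0,\ldots,Q_k$ of subsets of $V$ such that (i) $Q_0=\emptyset$; (ii) for $i\ge1$, $v\in Q_i$ if and only if $|N(v)\cap(\mathcal{S}_{i-1}\cup Q_{i-1})|\ge\tau(v)$; (iii) $\mathcal{S}_k=\emptyset$; (iv) $Q_k=V$. Its size is $\sum_{i=0}^k|\mathcal{S}_i|$, and $\overleftrightarrow{MTT}(G,\tau)$ is the minimum size of a TTS of $(G,\tau)$. -}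

module Defs where

import Data.Nat.Properties
open import Algebra.Properties.CommutativeMonoid.Sum Data.Nat.Properties.+-0-commutativeMonoid using (sum)
open import Data.Fin using (Fin; zero; suc; inject₁; fromℕ)
open import Data.Fin.Subset using (Subset; ⊥; ⊤; _∈_; _∩_; _∪_; ∣_∣)
open import Data.Fin.Subset.Properties using (x∈p⇒∣p-x∣<∣p∣)
open import Data.List using (map; allFin)
open import Data.List.Extrema.Nat using (max)
open import Data.Nat using (ℕ; suc; _+_; _≤_; z≤n; s≤s; ⌈_/2⌉)
open import Data.Nat.Properties
  using (+-monoʳ-≤; ≤-trans; ≤-reflexive; ⌈n/2⌉-mono; n≡⌈n+n/2⌉)
open import Data.Product using (∃-syntax; Σ-syntax; _×_; proj₂)
open import Data.Vec using (tabulate)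
open import Data.Vec.Functional using (Vector)
open import Data.Vec.Properties using (lookup∘tabulate; lookup⇒[]=)
open import Function.Bundles using (_⇔_)
open import Level using (0ℓ)
open import Relation.Binary using (Rel; Symmetric; Irreflexive; Decidable)
open import Relation.Binary.PropositionalEquality using (_≡_; sym; trans)
open import Relation.Nullary using (does)
open import Relation.Nullary.Decidable using (dec-true)

record SimpleGraph (n : ℕ) : Set₁ where
  infix 4 _~_ _~?_
  field
    _~_    : Rel (Fin n) 0ℓ
    ~-sym  : Symmetric _~_
    ~-irr  : Irreflexive _≡_ _~_
    _~?_   : Decidable _~_

  N : Fin n → Subset n
  N v = tabulate (λ u → does (v ~? u))

  d : Fin n → ℕ
  d v = ∣ N v ∣

  Δ : ℕ
  Δ = max 0 (map d (allFin n))

  NoIsolated : Set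
  NoIsolated = ∀ v → ∃[ u ] v ~ u

  ~⇒∈N : ∀ {u v} → v ~ u → u ∈ N v
  ~⇒∈N {u} {v} v~u = lookup⇒[]= u (N v)
    (trans (lookup∘tabulate (λ w → does (v ~? w)) u) (dec-true (v ~? u) v~u))

  1≤d : NoIsolated → ∀ v → 1 ≤ d v
  1≤d noIso v = ≤-trans (s≤s z≤n) (x∈p⇒∣p-x∣<∣p∣ (~⇒∈N (proj₂ (noIso v))))

record ThresholdAssignment {n : ℕ} (G : SimpleGraph n) : Set where
  open SimpleGraph G
  field
    τ   : Fin n → ℕ
    τ≤d : ∀ v → τ v ≤ d v

-- The bound ⌈ (d v + 1) / 2 ⌉ ≤ d v fails exactly at isolated vertices.
strictMajority : ∀ {n} (G : SimpleGraph n) → SimpleGraph.NoIsolated G → ThresholdAssignment G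
strictMajority G noIso = record
  { τ   = λ v → ⌈ d v + 1 /2⌉
  ; τ≤d = λ v → ≤-trans (⌈n/2⌉-mono (+-monoʳ-≤ (d v) (1≤d noIso v)))
                        (≤-reflexive (sym (n≡⌈n+n/2⌉ (d v))))
  }
  where open SimpleGraph G

-- A sequence S₀ , … , S_k is a vector of length suc k.
SubsetSeq : ℕ → ℕ → Set
SubsetSeq n k = Vector (Subset n) (suc k)

size : ∀ {n k} → SubsetSeq n k → ℕ
size S = sum (λ i → ∣ S i ∣)

module _ {n : ℕ} (G : SimpleGraph n) (T : ThresholdAssignment G) where
  open SimpleGraph G
  open ThresholdAssignment T

  -- The model is non-progressive: Q_{i+1} need not contain Q_i.
  record IsActivation {k : ℕ} (S Q : SubsetSeq n k) : Set where
    field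
      Q-start : Q zero ≡ ⊥
      Q-step  : ∀ (i : Fin k) (v : Fin n) →
                v ∈ Q (suc i) ⇔ τ v ≤ ∣ N v ∩ (S (inject₁ i) ∪ Q (inject₁ i)) ∣
      S-end   : S (fromℕ k) ≡ ⊥
      Q-end   : Q (fromℕ k) ≡ ⊤

  IsTTS : {k : ℕ} → SubsetSeq n k → Set
  IsTTS {k} S = Σ[ Q ∈ SubsetSeq n k ] IsActivation S Q

  -- m is the minimum size of a TTS, over sequences of every length.
  record IsMTT (m : ℕ) : Set where
    field
      attained : ∃[ k ] Σ[ S ∈ SubsetSeq n k ] IsTTS S × size S ≡ m
      minimal  : ∀ {k} (S : SubsetSeq n k) → IsTTS S → m ≤ size S

{-# OPTIONS --safe #-}

-- With A i = S i ∪ Q i, consider the energy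
--   E (X , A) = Σ_{v ∈ X} (d v + 1) + Σ_{v ∈ A} (d v + 1) - 2 e(X , A),
-- where e(X , A) counts the ordered pairs (x , a) ∈ X × A with x ~ a. By symmetry of e,
-- passing from (A (i-1) , A i) to (A i , A (i+1)) changes it by
--   Σ_v ([v ∈ A (i+1)] - [v ∈ A (i-1)]) (d v + 1 - 2 |N v ∩ A i|),
-- and the majority rule makes the terms with v ∉ S (i+1) nonpositive, while the others
-- are at most Δ + 1. Thus the energy grows from E (∅ , ∅) = 0 to at most (Δ + 1) Σ |S i|,
-- whereas E (X , V) ≥ 2 n for every X as no vertex is isolated.
module Submission where

open import Defs
open import Data.Bool using (Bool; true; false; _∧_; _∨_; if_then_else_)
open import Data.Fin using (Fin; zero; suc; inject₁; fromℕ)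
open import Data.Fin.Subset using (Subset; ⊥; ⊤; _∈_; _∩_; _∪_; ∣_∣)
open import Data.Fin.Subset.Properties using (∪-identityˡ; ∪-identityʳ; ∩-identityʳ)
open import Data.Integer as ℤ using (+_)
open import Data.List using (map; allFin)
open import Data.List.Extrema.Nat using (xs≤max)
open import Data.List.Membership.Propositional.Properties using (∈-map⁺; ∈-allFin)
import Data.List.Relation.Unary.All as All
open import Data.Nat using (ℕ; zero; suc; _+_; _*_; _≤_; _<_; z≤n; s≤s; s≤s⁻¹; ⌈_/2⌉; ⌊_/2⌋)
open import Data.Nat.Properties
import Data.Integer.Properties as ℤ
open import Data.Nat.Tactic.RingSolver using (solve-∀)
open import Data.Product using (_,_)
open import Data.Rational using (_/_; _≥_)
import Data.Rational.Properties as ℚ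
import Data.Rational.Unnormalised as ℚᵘ
import Data.Rational.Unnormalised.Properties as ℚᵘ
open import Data.Vec using (_∷_; []; lookup)
open import Data.Vec.Properties using (lookup-zipWith; lookup∘tabulate; lookup-replicate; lookup⇒[]=; []=⇒lookup)
open import Function using (_∘_)
open import Function.Bundles using (_⇔_; Equivalence)
open import Relation.Binary.PropositionalEquality
open import Relation.Nullary using (does; contradiction)
open import Relation.Nullary.Decidable using (does-⇔)
open import Algebra.Properties.CommutativeMonoid.Sum +-0-commutativeMonoid
  using (sum; sum-cong-≗; ∑-distrib-+; ∑-comm)
open import Algebra.Properties.Semiring.Sum +-*-semiring using (*-distribˡ-sum)

-- Finite sums and Boolean indicators.

sum-mono-≤ : ∀ {n} {f g : Fin n → ℕ} → (∀ i → f i ≤ g i) → sum f ≤ sum g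
sum-mono-≤ {zero}  f≤g = z≤n
sum-mono-≤ {suc n} f≤g = +-mono-≤ (f≤g zero) (sum-mono-≤ (f≤g ∘ suc))

sum-const : ∀ n c → sum {n} (λ _ → c) ≡ c * n
sum-const zero    c = sym (*-zeroʳ c)
sum-const (suc n) c = trans (cong (λ s → c + s) (sum-const n c)) (sym (*-suc c n))

sum-linear : ∀ {n} c (f g : Fin n → ℕ) → sum (λ i → f i + c * g i) ≡ sum f + c * sum g
sum-linear c f g = trans (∑-distrib-+ f (λ i → c * g i))
                         (cong (λ s → sum f + s) (sym (*-distribˡ-sum c g)))

infixr 8 _·_

-- The Iverson bracket of `b` times `x`. It reduces once `b` is a literal, so case splits on
-- memberships leave plain arithmetic.
_·_ : Bool → ℕ → ℕ
b · x = if b then x else 0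

·-sum : ∀ {n} b (f : Fin n → ℕ) → b · sum f ≡ sum (λ i → b · f i)
·-sum     true  f = refl
·-sum {n} false f = sym (sum-const n 0)

-- Exchanges the endpoints of an ordered pair in a double sum; `c` is their adjacency.
∧-swap-· : ∀ a b c x → a · (c ∧ b) · x ≡ b · (c ∧ a) · x
∧-swap-· true  true  c     x = refl
∧-swap-· true  false true  x = refl
∧-swap-· true  false false x = refl
∧-swap-· false true  true  x = refl
∧-swap-· false true  false x = refl
∧-swap-· false false c     x = refl

∣p∣≡sum : ∀ {n} (p : Subset n) → ∣ p ∣ ≡ sum (λ i → lookup p i · 1)
∣p∣≡sum []          = refl
∣p∣≡sum (true  ∷ p) = cong suc (∣p∣≡sum p)
∣p∣≡sum (false ∷ p) = ∣p∣≡sum p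

-- The majority threshold and the inequalities at a single vertex.

m≤⌈m/2⌉+⌈m/2⌉ : ∀ m → m ≤ ⌈ m /2⌉ + ⌈ m /2⌉
m≤⌈m/2⌉+⌈m/2⌉ m = begin
  m                   ≡⟨ ⌊n/2⌋+⌈n/2⌉≡n m ⟨
  ⌊ m /2⌋ + ⌈ m /2⌉   ≤⟨ +-monoˡ-≤ _ (⌊n/2⌋≤⌈n/2⌉ m) ⟩
  ⌈ m /2⌉ + ⌈ m /2⌉   ∎
  where open ≤-Reasoning

⌈m/2⌉+⌈m/2⌉≤1+m : ∀ m → ⌈ m /2⌉ + ⌈ m /2⌉ ≤ suc m
⌈m/2⌉+⌈m/2⌉≤1+m m = begin
  ⌈ m /2⌉ + ⌈ m /2⌉           ≤⟨ +-monoʳ-≤ ⌈ m /2⌉ (⌊n/2⌋≤⌈n/2⌉ (suc m)) ⟩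
  ⌊ suc m /2⌋ + ⌈ suc m /2⌉   ≡⟨ ⌊n/2⌋+⌈n/2⌉≡n (suc m) ⟩
  suc m                       ∎
  where open ≤-Reasoning

⌈m/2⌉≤a⇒m≤2a : ∀ m a → ⌈ m /2⌉ ≤ a → m ≤ 2 * a
⌈m/2⌉≤a⇒m≤2a m a h = begin
  m                   ≤⟨ m≤⌈m/2⌉+⌈m/2⌉ m ⟩
  ⌈ m /2⌉ + ⌈ m /2⌉   ≤⟨ +-mono-≤ h h ⟩
  a + a               ≡⟨ cong (λ b → a + b) (+-identityʳ a) ⟨
  2 * a               ∎
  where open ≤-Reasoning

-- Doubling the rounded half may exceed `m` by one. Using the strict hypothesis in one of the two
-- summands pays for this.
a<⌈m/2⌉⇒2a≤m : ∀ m a → a < ⌈ m /2⌉ → 2 * a ≤ m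
a<⌈m/2⌉⇒2a≤m m a h = s≤s⁻¹ (begin
  suc (2 * a)         ≡⟨ cong (λ b → suc (a + b)) (+-identityʳ a) ⟩
  suc a + a           ≤⟨ +-mono-≤ h (<⇒≤ h) ⟩
  ⌈ m /2⌉ + ⌈ m /2⌉   ≤⟨ ⌈m/2⌉+⌈m/2⌉≤1+m m ⟩
  suc m               ∎)
  where open ≤-Reasoning

-- Here s, q, x are the truth values of v ∈ S (i+1), v ∈ Q (i+1), v ∈ A (i-1), while
-- w = d v + 1 and a = |N v ∩ A i|.
vertex-step : ∀ {w a c} s q x →
  (q ≡ true → w ≤ 2 * a) → (q ≡ false → 2 * a ≤ w) → w ≤ c →
  (s ∨ q) · w + 2 * (x · a) ≤ (x · w + 2 * ((s ∨ q) · a)) + c * (s · 1)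
vertex-step true  q     true  on off w≤c = m≤m+n _ _
-- A seeded vertex that was outside `A (i-1)`: the only case that spends the cost term.
vertex-step {w} {a} {c} true  q     false on off w≤c = begin
  w + 0           ≡⟨ +-identityʳ w ⟩
  w               ≤⟨ w≤c ⟩
  c               ≡⟨ *-identityʳ c ⟨
  c * 1           ≤⟨ m≤n+m _ (2 * a) ⟩
  2 * a + c * 1   ∎
  where open ≤-Reasoning
vertex-step false true  true  on off w≤c = m≤m+n _ _
vertex-step {w} {a} {c} false true  false on off w≤c = begin
  w + 0           ≡⟨ +-identityʳ w ⟩
  w               ≤⟨ on refl ⟩
  2 * a           ≤⟨ m≤m+n _ _ ⟩
  2 * a + c * 0   ∎
  where open ≤-Reasoning
vertex-step {w} {a} {c} false false true  on off w≤c = begin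
  2 * a           ≤⟨ off refl ⟩
  w               ≤⟨ m≤m+n _ _ ⟩
  w + 0           ≤⟨ m≤m+n _ _ ⟩
  w + 0 + c * 0   ∎
  where open ≤-Reasoning
vertex-step false false false on off w≤c = z≤n

-- One vertex's share of `E (X , V) ≥ 2 n`, with the edge term moved to the left. It is an equality
-- for a vertex of `X`; otherwise it says that `d + 1` is at least 2.
vertex-final : ∀ {d} x → 1 ≤ d → 2 + 2 * (x · d) ≤ suc d + x · suc d
vertex-final {d} true  1≤d = ≤-reflexive (eq d)
  where
  eq : ∀ d → 2 + 2 * d ≡ suc d + suc d
  eq = solve-∀
vertex-final {d} false 1≤d = ≤-trans (s≤s 1≤d) (≤-reflexive (sym (+-identityʳ (suc d))))

-- Weights, edge counts and the energy argument.

module _ {n : ℕ} (G : SimpleGraph n) where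
  open SimpleGraph G

  weight : Subset n → ℕ
  weight A = sum (λ v → lookup A v · suc (d v))

  edges : Subset n → Subset n → ℕ
  edges A B = sum (λ v → lookup A v · ∣ N v ∩ B ∣)

  d≤Δ : ∀ v → d v ≤ Δ
  d≤Δ v = All.lookup (xs≤max 0 (map d (allFin n))) (∈-map⁺ d (∈-allFin v))

  weight-⊥ : weight ⊥ ≡ 0
  weight-⊥ = trans (sum-cong-≗ (λ v → cong (_· suc (d v)) (lookup-replicate v false))) (sum-const n 0)

  -- A double sum treats both endpoints alike, which prepares the interchange of summation in
  -- `edges-sym`.
  edges-expand : ∀ A B →
    edges A B ≡ sum (λ v → sum (λ u → lookup A v · (does (v ~? u) ∧ lookup B u) · 1))
  edges-expand A B = sum-cong-≗ λ v → begin
    lookup A v · ∣ N v ∩ B ∣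
      ≡⟨ cong (lookup A v ·_) (∣p∣≡sum (N v ∩ B)) ⟩
    lookup A v · sum (λ u → lookup (N v ∩ B) u · 1)
      ≡⟨ ·-sum (lookup A v) (λ u → lookup (N v ∩ B) u · 1) ⟩
    sum (λ u → lookup A v · lookup (N v ∩ B) u · 1)
      ≡⟨ sum-cong-≗ (λ u → cong (λ b → lookup A v · b · 1)
           (trans (lookup-zipWith _∧_ u (N v) B) (cong (_∧ lookup B u) (lookup∘tabulate _ u)))) ⟩
    sum (λ u → lookup A v · (does (v ~? u) ∧ lookup B u) · 1) ∎
    where open ≡-Reasoning

  edges-sym : ∀ A B → edges A B ≡ edges B A
  edges-sym A B = begin
    edges A B
      ≡⟨ edges-expand A B ⟩
    sum (λ v → sum (λ u → lookup A v · (does (v ~? u) ∧ lookup B u) · 1))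
      ≡⟨ ∑-comm (λ v u → lookup A v · (does (v ~? u) ∧ lookup B u) · 1) ⟩
    sum (λ u → sum (λ v → lookup A v · (does (v ~? u) ∧ lookup B u) · 1))
      ≡⟨ sum-cong-≗ (λ u → sum-cong-≗ (λ v → swap u v)) ⟩
    sum (λ u → sum (λ v → lookup B u · (does (u ~? v) ∧ lookup A v) · 1))
      ≡⟨ edges-expand B A ⟨
    edges B A ∎
    where
    open ≡-Reasoning
    swap : ∀ u v → lookup A v · (does (v ~? u) ∧ lookup B u) · 1
                 ≡ lookup B u · (does (u ~? v) ∧ lookup A v) · 1
    swap u v = trans (∧-swap-· (lookup A v) (lookup B u) (does (v ~? u)) 1)
      (cong (λ b → lookup B u · (b ∧ lookup A v) · 1) (does-⇔ (record
        { to = ~-sym ; from = ~-sym ; to-cong = cong ~-sym ; from-cong = cong ~-sym })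
        (v ~? u) (u ~? v)))

  weight≤cost : ∀ S → weight S ≤ suc Δ * ∣ S ∣
  weight≤cost S = begin
    weight S                              ≤⟨ sum-mono-≤ (λ v → pointwise v (lookup S v)) ⟩
    sum (λ v → suc Δ * (lookup S v · 1))  ≡⟨ *-distribˡ-sum (suc Δ) (λ v → lookup S v · 1) ⟨
    suc Δ * sum (λ v → lookup S v · 1)    ≡⟨ cong (suc Δ *_) (∣p∣≡sum S) ⟨
    suc Δ * ∣ S ∣                         ∎
    where
    open ≤-Reasoning
    pointwise : ∀ v b → b · suc (d v) ≤ suc Δ * (b · 1)
    pointwise v true  = ≤-trans (s≤s (d≤Δ v)) (≤-reflexive (sym (*-identityʳ (suc Δ))))
    pointwise v false = z≤n

  module _ (noIso : NoIsolated) where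
    open ThresholdAssignment (strictMajority G noIso)

    -- The growth of the energy in one step, with negative terms moved across to stay in the
    -- naturals. Both edge counts are taken against the same `A`, so the inequality splits into one
    -- instance of `vertex-step` per vertex.
    energy-step : ∀ X A S Q → (∀ v → v ∈ Q ⇔ τ v ≤ ∣ N v ∩ A ∣) →
      weight (S ∪ Q) + 2 * edges X A ≤ (weight X + 2 * edges (S ∪ Q) A) + suc Δ * ∣ S ∣
    energy-step X A S Q rule = begin
      weight (S ∪ Q) + 2 * edges X A
        ≡⟨ sum-linear 2 (λ v → lookup (S ∪ Q) v · suc (d v)) _ ⟨
      sum (λ v → lookup (S ∪ Q) v · suc (d v) + 2 * (lookup X v · ∣ N v ∩ A ∣))
        ≤⟨ sum-mono-≤ pointwise ⟩
      sum (λ v → (lookup X v · suc (d v) + 2 * (lookup (S ∪ Q) v · ∣ N v ∩ A ∣)) + suc Δ * (lookup S v · 1))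
        ≡⟨ sum-linear (suc Δ) (λ v → lookup X v · suc (d v) + 2 * (lookup (S ∪ Q) v · ∣ N v ∩ A ∣)) _ ⟩
      sum (λ v → lookup X v · suc (d v) + 2 * (lookup (S ∪ Q) v · ∣ N v ∩ A ∣)) + suc Δ * sum (λ v → lookup S v · 1)
        ≡⟨ cong₂ _+_ (sum-linear 2 (λ v → lookup X v · suc (d v)) _) (cong (suc Δ *_) (sym (∣p∣≡sum S))) ⟩
      (weight X + 2 * edges (S ∪ Q) A) + suc Δ * ∣ S ∣ ∎
      where
      open ≤-Reasoning
      on : ∀ v → lookup Q v ≡ true → suc (d v) ≤ 2 * ∣ N v ∩ A ∣
      on v q = ⌈m/2⌉≤a⇒m≤2a (suc (d v)) ∣ N v ∩ A ∣ (subst (λ m → ⌈ m /2⌉ ≤ ∣ N v ∩ A ∣) (+-comm (d v) 1)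
        (Equivalence.to (rule v) (lookup⇒[]= v Q q)))
      off : ∀ v → lookup Q v ≡ false → 2 * ∣ N v ∩ A ∣ ≤ suc (d v)
      off v ¬q = a<⌈m/2⌉⇒2a≤m (suc (d v)) ∣ N v ∩ A ∣ (subst (λ m → ∣ N v ∩ A ∣ < ⌈ m /2⌉) (+-comm (d v) 1)
        (≰⇒> λ τ≤a → contradiction
          (trans (sym ([]=⇒lookup (Equivalence.from (rule v) τ≤a))) ¬q) λ ()))
      pointwise : ∀ v →
        lookup (S ∪ Q) v · suc (d v) + 2 * (lookup X v · ∣ N v ∩ A ∣)
        ≤ (lookup X v · suc (d v) + 2 * (lookup (S ∪ Q) v · ∣ N v ∩ A ∣)) + suc Δ * (lookup S v · 1)
      pointwise v rewrite lookup-zipWith _∨_ v S Q =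
        vertex-step (lookup S v) (lookup Q v) (lookup X v) (on v) (off v) (s≤s (d≤Δ v))

    energy-final : ∀ X → 2 * n + 2 * edges X ⊤ ≤ weight ⊤ + weight X
    energy-final X = begin
      2 * n + 2 * edges X ⊤
        ≡⟨ cong (_+ 2 * edges X ⊤) (sum-const n 2) ⟨
      sum {n} (λ _ → 2) + 2 * edges X ⊤
        ≡⟨ sum-linear 2 (λ _ → 2) (λ v → lookup X v · ∣ N v ∩ ⊤ ∣) ⟨
      sum (λ v → 2 + 2 * (lookup X v · ∣ N v ∩ ⊤ ∣))
        ≤⟨ sum-mono-≤ pointwise ⟩
      sum (λ v → lookup ⊤ v · suc (d v) + lookup X v · suc (d v))
        ≡⟨ ∑-distrib-+ (λ v → lookup ⊤ v · suc (d v)) _ ⟩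
      weight ⊤ + weight X ∎
      where
      open ≤-Reasoning
      pointwise : ∀ v → 2 + 2 * (lookup X v · ∣ N v ∩ ⊤ ∣)
                        ≤ lookup ⊤ v · suc (d v) + lookup X v · suc (d v)
      pointwise v rewrite ∩-identityʳ (N v) | lookup-replicate v true =
        vertex-final (lookup X v) (1≤d noIso v)

    -- X stands for the set A (i-1) preceding S zero ∪ Q zero; being arbitrary, it lets the
    -- induction pass to the tail of the sequence.
    energy-bound : ∀ {k} X (S Q : SubsetSeq n k) →
      (∀ i v → v ∈ Q (suc i) ⇔ τ v ≤ ∣ N v ∩ (S (inject₁ i) ∪ Q (inject₁ i)) ∣) →
      S (fromℕ k) ≡ ⊥ → Q (fromℕ k) ≡ ⊤ →
      2 * n + 2 * edges X (S zero ∪ Q zero)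
        ≤ (weight (S zero ∪ Q zero) + weight X) + suc Δ * sum (λ i → ∣ S (suc i) ∣)
    -- At the last time `S` is empty and `Q` is full, so the current set is `⊤`.
    energy-bound {zero} X S Q rule S≡⊥ Q≡⊤ rewrite S≡⊥ | Q≡⊤ | ∪-identityˡ (⊤ {n}) =
      ≤-trans (energy-final X) (m≤m+n _ _)
    energy-bound {suc k} X S Q rule S≡⊥ Q≡⊤ =
      combine (weight A) (weight A′) (weight X) (edges X A) (edges A A′) (suc Δ)
        ∣ S (suc zero) ∣ (sum (λ i → ∣ S (suc (suc i)) ∣))
        (energy-bound A (S ∘ suc) (Q ∘ suc) (rule ∘ suc) S≡⊥ Q≡⊤)
        -- The step produces `edges A′ A` and the induction hypothesis `edges A A′`; symmetry
        -- identifies them, so that they cancel.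
        (subst (λ e → weight A′ + 2 * edges X A ≤ (weight X + 2 * e) + suc Δ * ∣ S (suc zero) ∣)
          (edges-sym A′ A) (energy-step X A (S (suc zero)) (Q (suc zero)) (rule zero)))
      where
      A A′ : Subset n
      A  = S zero ∪ Q zero
      A′ = S (suc zero) ∪ Q (suc zero)
      combine : ∀ w w′ x e f c s t →
        2 * n + 2 * f ≤ (w′ + w) + c * t →
        w′ + 2 * e ≤ (x + 2 * f) + c * s →
        2 * n + 2 * e ≤ (w + x) + c * (s + t)
      combine w w′ x e f c s t later now =
        -- The telescoping: `w′` and `2 * f` occur on opposite sides of the two hypotheses.
        +-cancelʳ-≤ (w′ + 2 * f) _ _ (begin
          (2 * n + 2 * e) + (w′ + 2 * f)               ≡⟨ left n e w′ f ⟩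
          (2 * n + 2 * f) + (w′ + 2 * e)               ≤⟨ +-mono-≤ later now ⟩
          ((w′ + w) + c * t) + ((x + 2 * f) + c * s)   ≡⟨ right w w′ x f c s t ⟩
          ((w + x) + c * (s + t)) + (w′ + 2 * f)       ∎)
        where
        open ≤-Reasoning
        left : ∀ n e w′ f → (2 * n + 2 * e) + (w′ + 2 * f) ≡ (2 * n + 2 * f) + (w′ + 2 * e)
        left = solve-∀
        right : ∀ w w′ x f c s t → ((w′ + w) + c * t) + ((x + 2 * f) + c * s)
                                   ≡ ((w + x) + c * (s + t)) + (w′ + 2 * f)
        right = solve-∀

    TTS-size : ∀ {k} (S : SubsetSeq n k) → IsTTS G (strictMajority G noIso) S →
      2 * n ≤ suc Δ * size S
    TTS-size S (Q , act) = begin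
      2 * n
        ≤⟨ m≤m+n _ _ ⟩
      2 * n + 2 * edges ⊥ (S zero ∪ Q zero)
        -- With the empty set before time zero, the initial energy is the weight of `S zero`, which
        -- the seeds at time zero pay for.
        ≤⟨ energy-bound ⊥ S Q Q-step S-end Q-end ⟩
      (weight (S zero ∪ Q zero) + weight ⊥) + suc Δ * later
        ≡⟨ cong (_+ suc Δ * later) (trans (cong₂ _+_ (cong weight A₀≡S₀) weight-⊥) (+-identityʳ _)) ⟩
      weight (S zero) + suc Δ * later
        ≤⟨ +-monoˡ-≤ _ (weight≤cost (S zero)) ⟩
      suc Δ * ∣ S zero ∣ + suc Δ * later
        ≡⟨ *-distribˡ-+ (suc Δ) ∣ S zero ∣ later ⟨
      suc Δ * size S ∎
      where
      open ≤-Reasoning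
      open IsActivation act
      later = sum (λ i → ∣ S (suc i) ∣)
      A₀≡S₀ : S zero ∪ Q zero ≡ S zero
      A₀≡S₀ = trans (cong (S zero ∪_) Q-start) (∪-identityʳ (S zero))

-- Cross-multiplication, done on unnormalised rationals because `_/_` reduces to lowest terms.
a≤cb⇒a/c≤b : ∀ {a b c} → a ≤ suc c * b → (+ b) / 1 ≥ (+ a) / suc c
a≤cb⇒a/c≤b {a} {b} {c} h = ℚ.toℚᵘ-cancel-≤
  (ℚᵘ.≤-respˡ-≃ (ℚᵘ.≃-sym (ℚ.toℚᵘ-fromℚᵘ (ℚᵘ.mkℚᵘ (+ a) c)))
  (ℚᵘ.≤-respʳ-≃ (ℚᵘ.≃-sym (ℚ.toℚᵘ-fromℚᵘ (ℚᵘ.mkℚᵘ (+ b) 0)))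
  (ℚᵘ.*≤* (subst₂ ℤ._≤_ (ℤ.pos-* a 1) (ℤ.pos-* b (suc c))
    (ℤ.+≤+ (subst₂ _≤_ (sym (*-identityʳ a)) (*-comm (suc c) b) h))))))

theorem4 : ∀ {n : ℕ} (G : SimpleGraph n) (noIso : SimpleGraph.NoIsolated G) (m : ℕ) →
    IsMTT G (strictMajority G noIso) m →
    (+ m) / 1 ≥ (+ (2 * n)) / suc (SimpleGraph.Δ G)
theorem4 G noIso m mtt with IsMTT.attained mtt
-- The bound holds for every TTS, in particular for one of size `m`.
... | _ , S , tts , refl = a≤cb⇒a/c≤b (TTS-size G noIso S tts)
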